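{- Let $G\in\mathscr{B}$ with $\operatorname{diam}(G)\ge 4$. Then the eccentricity matrix $E(G)$ is irreducible.
   Context: All graphs are finite, simple and connected; $d(u,v)$ is the distance in $G$, $e(u)=\max_v d(u,v)$, $\operatorname{diam}(G)=\max_u e(u)$. The eccentricity matrix $E(G)$ (vertices $v_1,\dots,v_n$) is the $n\times n$ matrix with $(i,j)$ entry $d(v_i,v_j)$ if $d(v_i,v_j)=\min\{e(v_i),e(v_j)\}$ and $0$ otherwise. A square matrix $M$ is irreducible if there is no permutation matrix $P$ such that $PMP^{T}$ is block upper triangular with at least two nonempty diagonal blocks; for a nonnegative symmetric matrix this is equivalent to the graph on the index set with an edge $\{i,j\}$ whenever $m_{ij}\neq0$ being connected. A block is a maximal connected subgraph without a cut-vertex. A bi-block graph is a connected graph all of whose blocks are complete bipartite graphs. $\mathscr{B}$ is the class of bi-block graphs with at least two blocks in which every block contains at most two cut-vertices of $G$. -}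

module Defs where

open import Data.Nat using (ℕ; zero; suc; _≤_; _<_; _⊔_; _⊓_; _≡ᵇ_)
open import Data.Bool using (if_then_else_)
open import Data.Fin using (Fin; toℕ)
open import Data.Fin.Subset using (Subset; _∈_; _∉_; _⊆_; _⊂_; _-_; ⊤; Nonempty)
open import Data.Fin.Permutation using (Permutation′; _⟨$⟩ʳ_)
open import Data.Product using (Σ; ∃; ∃-syntax; _×_; _,_)
open import Data.Sum using (_⊎_)
open import Relation.Nullary using (¬_)
open import Relation.Binary.PropositionalEquality using (_≡_; _≢_)

record Graph (n : ℕ) : Set₁ where
  field
    _~_    : Fin n → Fin n → Set
    ~-sym  : ∀ {u v} → u ~ v → v ~ u
    ~-irr  : ∀ {u} → ¬ (u ~ u)

module _ {n : ℕ} (G : Graph n) where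
  open Graph G

  data WalkIn (S : Subset n) : Fin n → Fin n → ℕ → Set where
    here : ∀ {u} → u ∈ S → WalkIn S u u 0
    step : ∀ {u w v k} → u ∈ S → u ~ w → WalkIn S w v k → WalkIn S u v (suc k)

  ConnectedIn : Subset n → Set
  ConnectedIn S = ∀ u v → u ∈ S → v ∈ S → ∃[ k ] WalkIn S u v k

  Connected : Set
  Connected = ConnectedIn ⊤

  IsCutVertexIn : Subset n → Fin n → Set
  IsCutVertexIn S v =
    v ∈ S × ∃[ a ] ∃[ b ] (a ∈ (S - v) × b ∈ (S - v) × ¬ (∃[ k ] WalkIn (S - v) a b k))

  IsCutVertex : Fin n → Set
  IsCutVertex = IsCutVertexIn ⊤

  Biconn : Subset n → Set
  Biconn S = Nonempty S × ConnectedIn S × (∀ v → ¬ IsCutVertexIn S v)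

  -- a block: maximal connected subgraph without a cut-vertex
  -- (such a maximal subgraph is always induced, so it is given by its vertex set)
  IsBlock : Subset n → Set
  IsBlock S = Biconn S × (∀ T → S ⊂ T → ¬ Biconn T)

  IsCompleteBipartite : Subset n → Set
  IsCompleteBipartite S =
    ∃[ A ] ∃[ B ]
      ( Nonempty A × Nonempty B
      × (∀ x → x ∈ S → (x ∈ A × x ∉ B) ⊎ (x ∈ B × x ∉ A))
      × A ⊆ S × B ⊆ S
      × (∀ x y → x ∈ S → y ∈ S →
           (x ~ y → (x ∈ A × y ∈ B) ⊎ (x ∈ B × y ∈ A))
         × ((x ∈ A × y ∈ B) ⊎ (x ∈ B × y ∈ A) → x ~ y)))

  IsBiBlock : Set
  IsBiBlock = Connected × (∀ S → IsBlock S → IsCompleteBipartite S)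

  InClassB : Set
  InClassB =
    IsBiBlock
    × (∃[ S ] ∃[ T ] (IsBlock S × IsBlock T × S ≢ T))
    × (∀ S → IsBlock S → ∀ a b c → a ∈ S → b ∈ S → c ∈ S →
         IsCutVertex a → IsCutVertex b → IsCutVertex c →
         a ≡ b ⊎ a ≡ c ⊎ b ≡ c)

  Dist : Fin n → Fin n → ℕ → Set
  Dist u v k = WalkIn ⊤ u v k × (∀ m → WalkIn ⊤ u v m → k ≤ m)

  Ecc : Fin n → ℕ → Set
  Ecc u e = (∃[ v ] Dist u v e) × (∀ v k → Dist u v k → k ≤ e)

  Diam : ℕ → Set
  Diam D = (∃[ u ] Ecc u D) × (∀ u e → Ecc u e → e ≤ D)

  IsEccMatrix : (Fin n → Fin n → ℕ) → Set
  IsEccMatrix M = ∀ i j dij ei ej → Dist i j dij → Ecc i ei → Ecc j ej →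
    M i j ≡ (if dij ≡ᵇ (ei ⊓ ej) then dij else 0)

-- Irreducibility of a square matrix (Fin n → Fin n → ℕ).
-- M is reducible iff for some permutation P, P M Pᵀ is block upper
-- triangular with at least two nonempty diagonal blocks, i.e. for some
-- permutation σ and some 0 < k < n the lower-left block
-- (rows ≥ k, columns < k) of (P M Pᵀ)_{ij} = M (σ i) (σ j) vanishes.

Reducible : ∀ {n} → (Fin n → Fin n → ℕ) → Set
Reducible {n} M =
  Σ (Permutation′ n) λ σ → ∃[ k ]
    ( 0 < k × k < n
    × (∀ i j → k ≤ toℕ i → toℕ j < k → M (σ ⟨$⟩ʳ i) (σ ⟨$⟩ʳ j) ≡ 0))

Irreducible : ∀ {n} → (Fin n → Fin n → ℕ) → Set
Irreducible M = ¬ Reducible M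

{-# OPTIONS --safe #-}
module Submission where

-- Let P and Q be diametral.  Every vertex u has P or Q among its farthest vertices, so in the graph
-- of E(G) the vertex u is adjacent to P or to Q, and P is adjacent to Q; hence E(G) is irreducible.
--
-- To find the farthest vertices, write a ≈ b when no third vertex separates a from b.  The maximal
-- cliques of ≈ are the blocks, so a ≈ b gives d a b ≤ 2, and three distinct cut vertices are never
-- pairwise ≈.  If z separates P from Q into two halves of equal length, then all distances from z are
-- at most that half and the claim follows by routing through z.  Otherwise take the separators c and
-- c′ of P and Q next to the midpoint on either side; then c ≈ c′.  If c or c′ cuts u or v off from
-- the strip between them, routing through it again bounds d u v by d u P or d u Q.  If not, u and v
-- share the block of c and c′, as a separator would yield a third cut vertex there; so
-- d u v ≤ 2 ≤ d P Q / 2, which is at most d u P or d u Q.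

open import Defs
open import Data.Nat using (ℕ; suc; _≤_; _<_; _+_; _≡ᵇ_; z≤n; s≤s; _≤?_)
open import Data.Nat.Properties
  using (+-mono-<-≤; +-monoʳ-<; <⇒≢; <-trans; ≰⇒>; ≤-pred; ≤-trans; ≤-reflexive; ≤-antisym;
         ≤-total; ≤∧≢⇒<; <⇒≤; <⇒≱; ≮⇒≥; <-irrefl; <-≤-trans; +-assoc; +-comm; +-suc; +-monoʳ-≤; +-mono-≤;
         +-cancelʳ-≤; +-cancelˡ-≡; n≤0⇒n≡0; m+n≡0⇒m≡0; m≤n+m; m≤n⇒m⊓n≡m;
         m≥n⇒m⊓n≡n; ≡⇒≡ᵇ; module ≤-Reasoning)
import Data.Nat as ℕ
open import Data.Nat.Induction using (<-wellFounded)
open import Data.Nat.Tactic.RingSolver using (solve-∀)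
open import Data.Bool using (true; if_then_else_)
open import Data.Bool.Properties using (T-≡)
open import Data.Fin using (Fin; toℕ; fromℕ<)
open import Data.Fin.Properties using (_≟_; all?; any?; sequence; toℕ-fromℕ<)
open import Data.Fin.Permutation using (_⟨$⟩ʳ_; _⟨$⟩ˡ_; inverseʳ; inverseˡ)
open import Data.Fin.Subset using (Subset; ∣_∣; _∈_; _∉_; _⊆_; _⊃_; _-_; ⊤; _∪_; ⁅_⁆; Nonempty)
open import Data.Fin.Subset.Induction using (⊃-wellFounded)
open import Data.Fin.Subset.Properties
  using (∈⊤; _∈?_; x∈⁅x⁆; x∈⁅y⁆⇒x≡y; x∈p∪q⁺; x∈p∪q⁻; p⊆p∪q; p─q⊆p; p─q─q≡p─q;
         x∈p∧x≢y⇒x∈p-y; x∈p⇒∣p-x∣<∣p∣)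
open import Data.List using (filter; allFin)
open import Data.List.Extrema.Nat using (argmax; argmax-all; f[xs]≤f[argmax])
open import Data.List.Membership.Propositional.Properties using (∈-filter⁺; ∈-allFin)
open import Data.List.Relation.Unary.All using (lookup)
open import Data.List.Relation.Unary.All.Properties using (all-filter)
open import Data.Product using (∃; ∃-syntax; _×_; _,_; proj₁; proj₂)
open import Data.Sum using (_⊎_; inj₁; inj₂; [_,_]′)
open import Data.Empty using (⊥)
open import Effect.Monad using (RawMonad)
open import Function using (_∘_; case_of_; Equivalence)
open import Induction.WellFounded using (Acc; acc)
open import Relation.Nullary using (¬_; Dec; yes; no; contradiction)
open import Relation.Nullary.Decidable using (¬?; _×-dec_; _→-dec_; ¬¬-excluded-middle; decidable-stable)
open import Relation.Nullary.Negation using (¬¬-Monad)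
open import Relation.Unary using (Decidable)
open import Relation.Binary.PropositionalEquality
  using (_≡_; _≢_; refl; sym; trans; cong; cong₂; subst; subst₂; ≢-sym)

-- Subsets, maxima and double negation

x∉p-x : ∀ {n} (p : Subset n) (x : Fin n) → x ∉ p - x
x∉p-x p x x∈ =
  <-irrefl (cong ∣_∣ (p─q─q≡p─q p ⁅ x ⁆)) (x∈p⇒∣p-x∣<∣p∣ x∈)

∈⊤- : ∀ {n} {x y : Fin n} → x ≢ y → x ∈ ⊤ - y
∈⊤- = x∈p∧x≢y⇒x∈p-y ∈⊤

∈-≢ : ∀ {n} {p : Subset n} {x y : Fin n} → x ∈ p - y → x ≢ y
∈-≢ {p = p} {x} x∈ refl = x∉p-x p x x∈

maximal : ∀ {n} {P : Fin n → Set} → Decidable P → (f : Fin n → ℕ) → ∃ P →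
          ∃[ m ] (P m × (∀ y → P y → f y ≤ f m))
maximal {n} {P} P? f (x , px) =
  argmax f x xs , argmax-all f {P = P} px (all-filter P? (allFin n)) ,
  λ y py → lookup (f[xs]≤f[argmax] {f = f} x xs) (∈-filter⁺ P? (∈-allFin y) py)
  where xs = filter P? (allFin n)

-- Lets classical facts be assumed for all vertices at once when the goal is `⊥`.
¬¬-∀ : ∀ {n} {P : Fin n → Set} → (∀ i → ¬ ¬ P i) → ¬ ¬ (∀ i → P i)
¬¬-∀ = sequence (RawMonad.rawApplicative ¬¬-Monad)

-- `P` need not be decidable: without a least witness, well-founded induction refutes `P`
-- everywhere.
¬¬-least : {P : ℕ → Set} → ∃ P → ¬ ¬ (∃[ k ] (P k × (∀ m → P m → k ≤ m)))
¬¬-least {P} (k , pk) none = go k (<-wellFounded k) pk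
  where
  go : ∀ k → Acc _<_ k → ¬ P k
  go k (acc smaller) pk =
    none (k , pk , λ m pm → ≮⇒≥ λ m<k → go m (smaller m<k) pm)

m+n≤n⇒m≡0 : ∀ m n → m + n ≤ n → m ≡ 0
m+n≤n⇒m≡0 m n le = n≤0⇒n≡0 (+-cancelʳ-≤ n m 0 le)

-- Walks and separation

module Walks {n : ℕ} (G : Graph n) where
  open Graph G

  start∈ : ∀ {S a b k} → WalkIn G S a b k → a ∈ S
  start∈ (here a∈)     = a∈
  start∈ (step a∈ _ _) = a∈

  end∈ : ∀ {S a b k} → WalkIn G S a b k → b ∈ S
  end∈ (here a∈)    = a∈
  end∈ (step _ _ w) = end∈ w

  length-0 : ∀ {S a b} → WalkIn G S a b 0 → a ≡ b
  length-0 (here _) = refl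

  mono : ∀ {S T a b k} → S ⊆ T → WalkIn G S a b k → WalkIn G T a b k
  mono S⊆T (here a∈)     = here (S⊆T a∈)
  mono S⊆T (step a∈ e w) = step (S⊆T a∈) e (mono S⊆T w)

  _++_ : ∀ {S a b c k l} → WalkIn G S a b k → WalkIn G S b c l → WalkIn G S a c (k + l)
  here _      ++ w′ = w′
  step a∈ e w ++ w′ = step a∈ e (w ++ w′)

  _∷ʳ_ : ∀ {S a b c k} → WalkIn G S a b k → b ~ c × c ∈ S → WalkIn G S a c (suc k)
  here a∈     ∷ʳ (e , c∈) = step a∈ e (here c∈)
  step a∈ e w ∷ʳ e′       = step a∈ e (w ∷ʳ e′)

  reverse : ∀ {S a b k} → WalkIn G S a b k → WalkIn G S b a k
  reverse (here a∈)     = here a∈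
  reverse (step a∈ e w) = reverse w ∷ʳ (~-sym e , a∈)

  -- The split is at the first visit to `y`; the exact length equation serves the minimality
  -- arguments.
  avoid-or-split : ∀ {S a b k} y → WalkIn G S a b k →
    WalkIn G (⊤ - y) a b k ⊎
    (∃[ i ] ∃[ j ] (i + j ≡ k × WalkIn G S a y i × WalkIn G S y b j))
  avoid-or-split {a = a} y w with a ≟ y
  ... | yes refl = inj₂ (0 , _ , refl , here (start∈ w) , w)
  avoid-or-split y (here a∈)     | no a≢y = inj₁ (here (∈⊤- a≢y))
  avoid-or-split y (step a∈ e w) | no a≢y with avoid-or-split y w
  ... | inj₁ w′ = inj₁ (step (∈⊤- a≢y) e w′)
  ... | inj₂ (i , j , refl , w₁ , w₂) = inj₂ (suc i , j , refl , step a∈ e w₁ , w₂)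

  Joined : Fin n → Fin n → Fin n → Set
  Joined z a b = ∃[ k ] WalkIn G (⊤ - z) a b k

  -- Holds trivially if `z` is `a` or `b`, as no walk in `⊤ - z` has `z` as an end. Endpoints thus
  -- count as separators.
  Sep : Fin n → Fin n → Fin n → Set
  Sep z a b = ¬ Joined z a b

  joined-sym : ∀ {z a b} → Joined z a b → Joined z b a
  joined-sym (k , w) = k , reverse w

  joined-trans : ∀ {z a b c} → Joined z a b → Joined z b c → Joined z a c
  joined-trans (k , w) (l , w′) = k + l , w ++ w′

  joined-≢ˡ : ∀ {z a b} → Joined z a b → a ≢ z
  joined-≢ˡ (_ , w) = ∈-≢ (start∈ w)

  joined-≢ʳ : ∀ {z a b} → Joined z a b → b ≢ z
  joined-≢ʳ (_ , w) = ∈-≢ (end∈ w)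

  sep-sym : ∀ {z a b} → Sep z a b → Sep z b a
  sep-sym s = s ∘ joined-sym

  infix 4 _≈_
  _≈_ : Fin n → Fin n → Set
  a ≈ b = ∀ z → z ≢ a → z ≢ b → Joined z a b

  ≈-refl : ∀ {a} → a ≈ a
  ≈-refl z z≢a _ = 0 , here (∈⊤- (≢-sym z≢a))

  ≈-sym : ∀ {a b} → a ≈ b → b ≈ a
  ≈-sym a≈b z z≢b z≢a = joined-sym (a≈b z z≢a z≢b)

  sep⇒cut : ∀ {z a b} → Sep z a b → a ≢ z → b ≢ z → IsCutVertex G z
  sep⇒cut s a≢z b≢z = ∈⊤ , _ , _ , ∈⊤- a≢z , ∈⊤- b≢z , s

-- Classically every finite connected graph provides d and joined?; they are parameters because
-- adjacency is not assumed decidable.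
module Geometry {n : ℕ} (G : Graph n)
  (d : Fin n → Fin n → ℕ) (isDist : ∀ u v → Dist G u v (d u v))
  (joined? : ∀ z a b → Dec (Walks.Joined G z a b)) where

  open Walks G

  -- Blocks as maximal cliques

  _≈?_ : ∀ a b → Dec (a ≈ b)
  a ≈? b = all? λ z → ¬? (z ≟ a) →-dec (¬? (z ≟ b) →-dec joined? z a b)

  Clique : Subset n → Set
  Clique S = ∀ x y → x ∈ S → y ∈ S → x ≈ y

  MaximalClique : Subset n → Set
  MaximalClique S = Clique S × (∀ x → (∀ s → s ∈ S → s ≈ x) → x ∈ S)

  extend : ∀ S → Acc _⊃_ S → Clique S → ∃[ T ] (S ⊆ T × MaximalClique T)
  extend S (acc larger) clique
    with any? (λ x → ¬? (x ∈? S) ×-dec all? (λ s → (s ∈? S) →-dec (s ≈? x)))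
  ... | no none = S , (λ x∈ → x∈) , clique , λ x x≈ →
          decidable-stable (x ∈? S) λ x∉ → none (x , x∉ , x≈)
  ... | yes (x , x∉ , x≈) =
          let T , S∪x⊆T , maxT = extend (S ∪ ⁅ x ⁆) (larger (p⊆p∪q _ , x , x∈S∪x , x∉)) clique′
          in T , S∪x⊆T ∘ p⊆p∪q _ , maxT
    where
    x∈S∪x : x ∈ S ∪ ⁅ x ⁆
    x∈S∪x = x∈p∪q⁺ (inj₂ (x∈⁅x⁆ x))
    clique′ : Clique (S ∪ ⁅ x ⁆)
    clique′ a b a∈ b∈ with x∈p∪q⁻ S _ a∈ | x∈p∪q⁻ S _ b∈
    ... | inj₁ a∈S | inj₁ b∈S = clique a b a∈S b∈S
    ... | inj₁ a∈S | inj₂ b∈x rewrite x∈⁅y⁆⇒x≡y x b∈x = x≈ a a∈S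
    ... | inj₂ a∈x | inj₁ b∈S rewrite x∈⁅y⁆⇒x≡y x a∈x = ≈-sym (x≈ b b∈S)
    ... | inj₂ a∈x | inj₂ b∈x rewrite x∈⁅y⁆⇒x≡y x a∈x | x∈⁅y⁆⇒x≡y x b∈x = ≈-refl

  -- A shortest walk does not visit y on both sides of x, so one of its two halves joins x to
  -- a or to b in the complement of y.
  shortest⊆clique : ∀ {R S a b x i j} → MaximalClique S → a ∈ S → b ∈ S →
    WalkIn G R a x i → WalkIn G R x b j → (∀ m → WalkIn G R a b m → i + j ≤ m) → x ∈ S
  shortest⊆clique {R} {S} {a} {b} {x} (clique , closed) a∈ b∈ p q least =
    closed x join
    where
    join : ∀ s → s ∈ S → ∀ y → y ≢ s → y ≢ x → Joined y s x
    join s s∈ y y≢s y≢x with avoid-or-split y p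
    ... | inj₁ p′ =
          joined-trans (clique s a s∈ a∈ y y≢s (≢-sym (∈-≢ (start∈ p′)))) (_ , p′)
    ... | inj₂ (i₁ , i₂ , refl , p₁ , p₂) with avoid-or-split y q
    ... | inj₁ q′ =
          joined-trans (clique s b s∈ b∈ y y≢s (≢-sym (∈-≢ (end∈ q′)))) (_ , reverse q′)
    ... | inj₂ (j₁ , j₂ , refl , q₁ , q₂) =
          contradiction (length-0 (subst (WalkIn G R y x) i₂≡0 p₂)) y≢x
      where
      i₂≡0 : i₂ ≡ 0
      i₂≡0 = m+n≡0⇒m≡0 i₂ (m+n≤n⇒m≡0 (i₂ + j₁) (i₁ + j₂)
        (≤-trans (≤-reflexive (exchange i₁ i₂ j₁ j₂)) (least _ (p₁ ++ q₂))))
        where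
        exchange : ∀ a b c e → (b + c) + (a + e) ≡ (a + b) + (c + e)
        exchange = solve-∀

  -- The part `p` already traversed is kept, so that `shortest⊆clique` applies at each vertex of the
  -- remaining walk. `R` is `⊤` for connectedness and `⊤ - v` for the absence of cut vertices.
  shortest-inside : ∀ {R S T a b x i j} → MaximalClique S → (∀ {x} → x ∈ R → x ∈ S → x ∈ T) →
    a ∈ S → b ∈ S → WalkIn G R a x i → WalkIn G R x b j →
    (∀ m → WalkIn G R a b m → i + j ≤ m) → WalkIn G T x b j
  shortest-inside maxS R∩S⊆T a∈ b∈ p (here x∈) least = here (R∩S⊆T x∈ b∈)
  shortest-inside {i = i} maxS R∩S⊆T a∈ b∈ p (step {k = k} x∈ e q) least =
    step (R∩S⊆T x∈ (shortest⊆clique maxS a∈ b∈ p (step x∈ e q) least)) e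
      (shortest-inside maxS R∩S⊆T a∈ b∈ (p ∷ʳ (e , start∈ q)) q
        λ m w → ≤-trans (≤-reflexive (sym (+-suc i k))) (least m w))

  maximalClique⇒biconn : ∀ {S} → MaximalClique S → Nonempty S → Biconn G S
  maximalClique⇒biconn {S} maxS nonempty = nonempty , connected , noCut
    where
    connected : ConnectedIn G S
    connected a b a∈ b∈ =
      let w , least = isDist a b
      in d a b , shortest-inside maxS (λ _ x∈ → x∈) a∈ b∈ (here (start∈ w)) w least
    noCut : ∀ v → ¬ IsCutVertexIn G S v
    noCut v (v∈ , a , b , a∈ , b∈ , separated) =
      -- A shortest walk in `⊤ - v` stays in `S`, hence in `S - v`. It exists up to double negation,
      -- enough for the goal `⊥`.
      ¬¬-least (proj₁ maxS a b (inS a∈) (inS b∈) v (≢-sym (∈-≢ a∈)) (≢-sym (∈-≢ b∈)))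
        λ { (k , w , least) → separated (k ,
              shortest-inside maxS (λ x∈R x∈S → x∈p∧x≢y⇒x∈p-y x∈S (∈-≢ x∈R))
                (inS a∈) (inS b∈) (here (start∈ w)) w least) }
      where
      inS : ∀ {x} → x ∈ S - v → x ∈ S
      inS = p─q⊆p S ⁅ v ⁆

  -- A separator inside `T` would be a cut vertex of `T`; one outside is avoided by every walk in
  -- `T`.
  biconn⇒clique : ∀ {T} → Biconn G T → Clique T
  biconn⇒clique {T} (_ , connected , noCut) x y x∈ y∈ z z≢x z≢y =
    decidable-stable (joined? z x y) λ separated →
      case z ∈? T of λ where
        (yes z∈) → noCut z (z∈ , x , y , x∈p∧x≢y⇒x∈p-y x∈ (≢-sym z≢x) , x∈p∧x≢y⇒x∈p-y y∈ (≢-sym z≢y) ,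
          λ { (k , w) → separated (k , mono (λ v∈ → ∈⊤- (∈-≢ v∈)) w) })
        (no z∉) → let k , w = connected x y x∈ y∈ in
          separated (k , mono (λ v∈ → ∈⊤- λ { refl → z∉ v∈ }) w)

  maximalClique⇒block : ∀ {S} → MaximalClique S → Nonempty S → IsBlock G S
  maximalClique⇒block maxS nonempty =
    maximalClique⇒biconn maxS nonempty ,
    λ { T (S⊆T , x , x∈T , x∉S) biconn →
        x∉S (proj₂ maxS x λ s s∈ → biconn⇒clique biconn s x (S⊆T s∈) x∈T) }

  -- Extends the triple to a maximal clique. Repetitions are allowed, which covers pairs.
  block-containing : ∀ {a b c} → a ≈ b → b ≈ c → a ≈ c →
    ∃[ S ] (IsBlock G S × a ∈ S × b ∈ S × c ∈ S)
  block-containing {a} {b} {c} a≈b b≈c a≈c =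
    let T , S⊆T , maxT = extend S (⊃-wellFounded S) clique
    in T , maximalClique⇒block maxT (a , S⊆T a∈) , S⊆T a∈ , S⊆T b∈ , S⊆T c∈
    where
    S = ⁅ a ⁆ ∪ (⁅ b ⁆ ∪ ⁅ c ⁆)
    a∈ : a ∈ S
    a∈ = x∈p∪q⁺ (inj₁ (x∈⁅x⁆ a))
    b∈ : b ∈ S
    b∈ = x∈p∪q⁺ (inj₂ (x∈p∪q⁺ (inj₁ (x∈⁅x⁆ b))))
    c∈ : c ∈ S
    c∈ = x∈p∪q⁺ (inj₂ (x∈p∪q⁺ (inj₂ (x∈⁅x⁆ c))))
    cases : ∀ {x} → x ∈ S → x ≡ a ⊎ x ≡ b ⊎ x ≡ c
    cases x∈ with x∈p∪q⁻ ⁅ a ⁆ _ x∈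
    ... | inj₁ x∈a = inj₁ (x∈⁅y⁆⇒x≡y a x∈a)
    ... | inj₂ x∈bc with x∈p∪q⁻ ⁅ b ⁆ _ x∈bc
    ... | inj₁ x∈b = inj₂ (inj₁ (x∈⁅y⁆⇒x≡y b x∈b))
    ... | inj₂ x∈c = inj₂ (inj₂ (x∈⁅y⁆⇒x≡y c x∈c))
    clique : Clique S
    clique x y x∈ y∈ with cases x∈ | cases y∈
    ... | inj₁ refl        | inj₁ refl        = ≈-refl
    ... | inj₁ refl        | inj₂ (inj₁ refl) = a≈b
    ... | inj₁ refl        | inj₂ (inj₂ refl) = a≈c
    ... | inj₂ (inj₁ refl) | inj₁ refl        = ≈-sym a≈b
    ... | inj₂ (inj₁ refl) | inj₂ (inj₁ refl) = ≈-refl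
    ... | inj₂ (inj₁ refl) | inj₂ (inj₂ refl) = b≈c
    ... | inj₂ (inj₂ refl) | inj₁ refl        = ≈-sym a≈c
    ... | inj₂ (inj₂ refl) | inj₂ (inj₁ refl) = ≈-sym b≈c
    ... | inj₂ (inj₂ refl) | inj₂ (inj₂ refl) = ≈-refl

  -- Distances, geodesics and separators

  walk : ∀ u v → WalkIn G ⊤ u v (d u v)
  walk u v = proj₁ (isDist u v)

  d-least : ∀ {u v m} → WalkIn G ⊤ u v m → d u v ≤ m
  d-least = proj₂ (isDist _ _) _

  d-sym : ∀ u v → d u v ≡ d v u
  d-sym u v = ≤-antisym (d-least (reverse (walk v u))) (d-least (reverse (walk u v)))

  d-refl : ∀ u → d u u ≡ 0
  d-refl u = n≤0⇒n≡0 (d-least (here ∈⊤))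

  d-triangle : ∀ u v w → d u w ≤ d u v + d v w
  d-triangle u v w = d-least (walk u v ++ walk v w)

  d≡0⇒≡ : ∀ {u v} → d u v ≡ 0 → u ≡ v
  d≡0⇒≡ {u} {v} eq = length-0 (subst (WalkIn G ⊤ u v) eq (walk u v))

  completeBipartite⇒d≤2 : ∀ {S a b} → IsCompleteBipartite G S → a ∈ S → b ∈ S → d a b ≤ 2
  completeBipartite⇒d≤2 {a = a} {b} (A , B , (x , x∈A) , (y , y∈B) , part , A⊆S , B⊆S , adj) a∈ b∈
    with part a a∈ | part b b∈
  ... | inj₁ (a∈A , _) | inj₂ (b∈B , _) = ≤-trans
        (d-least (step ∈⊤ (proj₂ (adj a b a∈ b∈) (inj₁ (a∈A , b∈B))) (here ∈⊤))) (s≤s z≤n)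
  ... | inj₂ (a∈B , _) | inj₁ (b∈A , _) = ≤-trans
        (d-least (step ∈⊤ (proj₂ (adj a b a∈ b∈) (inj₂ (a∈B , b∈A))) (here ∈⊤))) (s≤s z≤n)
  -- Vertices on the same side have a common neighbour on the other, nonempty side.
  ... | inj₁ (a∈A , _) | inj₁ (b∈A , _) = d-least
        (step ∈⊤ (proj₂ (adj a y a∈ (B⊆S y∈B)) (inj₁ (a∈A , y∈B)))
        (step ∈⊤ (proj₂ (adj y b (B⊆S y∈B) b∈) (inj₂ (y∈B , b∈A))) (here ∈⊤)))
  ... | inj₂ (a∈B , _) | inj₂ (b∈B , _) = d-least
        (step ∈⊤ (proj₂ (adj a x a∈ (A⊆S x∈A)) (inj₂ (a∈B , x∈A)))
        (step ∈⊤ (proj₂ (adj x b (A⊆S x∈A) b∈) (inj₁ (x∈A , b∈B))) (here ∈⊤)))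

  Between : Fin n → Fin n → Fin n → Set
  Between a x b = d a x + d x b ≡ d a b

  -- Every walk from `a` to `b` meets `x`, so a shortest one splits there.
  sep⇒between : ∀ {a x b} → Sep x a b → Between a x b
  sep⇒between {a} {x} {b} s with avoid-or-split x (walk a b)
  ... | inj₁ w = contradiction (d a b , w) s
  ... | inj₂ (i , j , i+j≡d , w₁ , w₂) = ≤-antisym
        (≤-trans (+-mono-≤ (d-least w₁) (d-least w₂)) (≤-reflexive i+j≡d)) (d-triangle a x b)

  between-sym : ∀ {a x b} → Between a x b → Between b x a
  between-sym {a} {x} {b} h =
    trans (cong₂ _+_ (d-sym b x) (d-sym x a)) (trans (+-comm (d x b) (d a x)) (trans h (d-sym a b)))

  -- A geodesic through x would otherwise have to pass through y on both sides of x.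
  between⇒joined : ∀ {a x b y} → Between a x b → y ≢ x → Joined y x a ⊎ Joined y x b
  between⇒joined {a} {x} {b} {y} h y≢x with joined? y x a | joined? y x b
  ... | yes j | _     = inj₁ j
  ... | no _  | yes j = inj₂ j
  ... | no sa | no sb = contradiction (sym (d≡0⇒≡ dxy≡0)) y≢x
    where
    open ≤-Reasoning
    exchange : ∀ p q r → (p + p) + (q + r) ≡ (p + q) + (p + r)
    exchange = solve-∀
    dxy≡0 : d x y ≡ 0
    dxy≡0 = m+n≡0⇒m≡0 (d x y) (m+n≤n⇒m≡0 (d x y + d x y) (d y a + d y b) (begin
      (d x y + d x y) + (d y a + d y b) ≡⟨ exchange (d x y) (d y a) (d y b) ⟩
      (d x y + d y a) + (d x y + d y b) ≡⟨ cong₂ _+_ (sep⇒between sa) (sep⇒between sb) ⟩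
      d x a + d x b                     ≡⟨ cong (_+ d x b) (d-sym x a) ⟩
      d a x + d x b                     ≡⟨ h ⟩
      d a b                             ≤⟨ d-triangle a y b ⟩
      d a y + d y b                     ≡⟨ cong (_+ d y b) (d-sym a y) ⟩
      d y a + d y b                     ∎))

  between⇒joined-end : ∀ {a x b} → Between a x b → b ≢ x → Joined b x a
  between⇒joined-end h b≢x with between⇒joined h b≢x
  ... | inj₁ j = j
  ... | inj₂ j = contradiction refl (joined-≢ʳ j)

  -- Routing through a separator of a diametral pair

  Diametral : Fin n → Fin n → Set
  Diametral P Q = ∀ x y → d x y ≤ d P Q

  diametral-sym : ∀ {P Q} → Diametral P Q → Diametral Q P
  diametral-sym {P} {Q} diam x y = ≤-trans (diam x y) (≤-reflexive (d-sym P Q))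

  sep-split : ∀ {z a b} c → Sep z a b → Sep z c a ⊎ Sep z c b
  sep-split {z} {a} {b} c s with joined? z c a
  ... | no s′ = inj₁ s′
  ... | yes j = inj₂ λ j′ → s (joined-trans (joined-sym j) j′)

  -- Both `v` and `P` reach `Q` through `c`; cancel `d c Q` from `d v Q ≤ d P Q`.
  shallow : ∀ {P Q c v} → Diametral P Q → Sep c P Q → Sep c v Q → d c v ≤ d P c
  shallow {P} {Q} {c} {v} diam sepPQ sepvQ = ≤-trans (≤-reflexive (d-sym c v))
    (+-cancelʳ-≤ (d c Q) (d v c) (d P c) (begin
      d v c + d c Q ≡⟨ sep⇒between sepvQ ⟩
      d v Q         ≤⟨ diam v Q ⟩
      d P Q         ≡⟨ sep⇒between sepPQ ⟨
      d P c + d c Q ∎))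
    where open ≤-Reasoning

  -- `c` separates `v` from `P` or from `Q`; `shallow` then gives the bound `d c Q` or `d P c`.
  deep : ∀ {P Q c} v → Diametral P Q → Sep c P Q → d P c ≤ d c Q → d c v ≤ d c Q
  deep {P} {Q} {c} v diam sepPQ Pc≤cQ with sep-split v sepPQ
  ... | inj₁ sepvP = ≤-trans (shallow (diametral-sym diam) (sep-sym sepPQ) sepvP)
                             (≤-reflexive (d-sym Q c))
  ... | inj₂ sepvQ = ≤-trans (shallow diam sepPQ sepvQ) Pc≤cQ

  -- By `deep`, `Q` is farthest from `c`, and `u` reaches `Q` only through `c`.
  farther-end : ∀ {P Q c u} v → Diametral P Q → Sep c P Q → d P c ≤ d c Q → Sep c u Q →
                d u v ≤ d u Q
  farther-end {P} {Q} {c} {u} v diam sepPQ Pc≤cQ sepuQ = begin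
    d u v         ≤⟨ d-triangle u c v ⟩
    d u c + d c v ≤⟨ +-monoʳ-≤ (d u c) (deep v diam sepPQ Pc≤cQ) ⟩
    d u c + d c Q ≡⟨ sep⇒between sepuQ ⟩
    d u Q         ∎
    where open ≤-Reasoning

  -- `u` reaches `P` only through `c`, and `v` is no farther from `c` than `P` is.
  opposite-end : ∀ {P Q c u v} → Diametral P Q → Sep c P Q → Joined c u Q → Sep c v Q →
                 d u v ≤ d u P
  opposite-end {P} {Q} {c} {u} {v} diam sepPQ juQ sepvQ = begin
    d u v         ≤⟨ d-triangle u c v ⟩
    d u c + d c v ≤⟨ +-monoʳ-≤ (d u c) (shallow diam sepPQ sepvQ) ⟩
    d u c + d P c ≡⟨ cong (d u c +_) (d-sym P c) ⟩
    d u c + d c P ≡⟨ sep⇒between (λ juP → sepPQ (joined-trans (joined-sym juP) juQ)) ⟩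
    d u P         ∎
    where open ≤-Reasoning

  -- Separators around the midpoint

  record Gap (P Q c c′ : Fin n) : Set where
    field
      sep      : Sep c P Q
      sep′     : Sep c′ P Q
      order    : Between P c c′
      order′   : Between c c′ Q
      c≢c′     : c ≢ c′
      together : c ≈ c′

  gap-sym : ∀ {P Q c c′} → Gap P Q c c′ → Gap Q P c′ c
  gap-sym gap = record
    { sep = sep-sym sep′ ; sep′ = sep-sym sep
    ; order = between-sym order′ ; order′ = between-sym order
    ; c≢c′ = ≢-sym c≢c′ ; together = ≈-sym together }
    where open Gap gap

  -- Among the vertices separating w from c, one nearest to c would share a block with c and c′.
  inside-gap : ∀ {P Q c c′ w} →
    (∀ a b c → a ≈ b → b ≈ c → a ≈ c → IsCutVertex G a → IsCutVertex G b → IsCutVertex G c →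
      a ≡ b ⊎ a ≡ c ⊎ b ≡ c) →
    Gap P Q c c′ → IsCutVertex G c → IsCutVertex G c′ → Joined c w Q → Joined c′ w P → w ≈ c
  inside-gap {P} {Q} {c} {c′} {w} twoCuts gap cut cut′ jwQ jwP z₀ z₀≢w z₀≢c =
    decidable-stable (joined? z₀ w c) λ sep₀ →
      -- Candidates lie between `c` and `w`, so the one farthest from `w` is nearest to `c`.
      let z , (z≢w , z≢c , sepz) , far = maximal candidate? (λ y → d y w) (z₀ , z₀≢w , z₀≢c , sep₀)
      in impossible z z≢w z≢c sepz λ y y≢w y≢c sepy → far y (y≢w , y≢c , sepy)
    where
    open Gap gap using (order; order′; c≢c′; together)
    Candidate : Fin n → Set
    Candidate z = z ≢ w × z ≢ c × Sep z w c
    candidate? : Decidable Candidate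
    candidate? z = ¬? (z ≟ w) ×-dec (¬? (z ≟ c) ×-dec ¬? (joined? z w c))
    impossible : ∀ z → z ≢ w → z ≢ c → Sep z w c →
      (∀ y → y ≢ w → y ≢ c → Sep y w c → d y w ≤ d z w) → ⊥
    impossible z z≢w z≢c sepz far =
      [ z≢c , [ z≢c′ , c≢c′ ]′ ]′
        (twoCuts z c c′ z≈c together z≈c′ (sep⇒cut sepz (≢-sym z≢w) (≢-sym z≢c)) cut cut′)
      where
      z-between : Between c z w
      z-between = sep⇒between (sep-sym sepz)
      z≢c′ : z ≢ c′
      z≢c′ refl = sepz (joined-trans jwP (joined-sym (between⇒joined-end order (≢-sym c≢c′))))
      nearer : ∀ y → y ≢ z → Sep y z c → Sep y w c
      nearer y y≢z sepyz jwc with between⇒joined z-between y≢z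
      ... | inj₁ jzc = sepyz jzc
      ... | inj₂ jzw = sepyz (joined-trans jzw jwc)
      z≈c : z ≈ c
      -- A vertex separating `z` from `c` would be a candidate farther from `w` than `z`.
      z≈c y y≢z y≢c = decidable-stable (joined? y z c) λ sepy →
        let sepyw = nearer y y≢z sepy
            y≢w : y ≢ w
            y≢w = λ { refl → sepy (between⇒joined-end z-between y≢z) }
            yz≡0 = m+n≤n⇒m≡0 (d y z) (d z w) (≤-trans (≤-reflexive (tail y sepy sepyw))
                     (far y y≢w y≢c sepyw))
        in y≢z (d≡0⇒≡ yz≡0)
        where
        open ≤-Reasoning
        tail : ∀ y → Sep y z c → Sep y w c → d y z + d z w ≡ d y w
        tail y sepy sepyw = +-cancelˡ-≡ (d c y) _ _ (begin-equality
          d c y + (d y z + d z w) ≡⟨ +-assoc (d c y) (d y z) (d z w) ⟨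
          (d c y + d y z) + d z w ≡⟨ cong (_+ d z w) (sep⇒between (sep-sym sepy)) ⟩
          d c z + d z w           ≡⟨ z-between ⟩
          d c w                   ≡⟨ sep⇒between (sep-sym sepyw) ⟨
          d c y + d y w           ∎)
      z≈c′ : z ≈ c′
      z≈c′ y y≢z y≢c′ with y ≟ c
      ... | no y≢c = joined-trans (z≈c y y≢z y≢c) (together y y≢c y≢c′)
      -- Avoiding `c`, one gets from `z` to `w`, on to `Q`, and back to `c′`.
      ... | yes refl = joined-trans (between⇒joined-end (between-sym z-between) y≢z)
            (joined-trans jwQ (joined-sym (between⇒joined-end (between-sym order′) c≢c′)))

  -- A single vertex `y` cannot be both `c` and `c′`, so one of them links `u` to `v` avoiding `y`.
  ≈-both⇒≈ : ∀ {c c′ u v} → c ≢ c′ → u ≈ c → u ≈ c′ → v ≈ c → v ≈ c′ → u ≈ v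
  ≈-both⇒≈ {c} c≢c′ u≈c u≈c′ v≈c v≈c′ y y≢u y≢v with y ≟ c
  ... | no y≢c   = joined-trans (u≈c y y≢u y≢c) (joined-sym (v≈c y y≢v y≢c))
  ... | yes refl = joined-trans (u≈c′ y y≢u c≢c′) (joined-sym (v≈c′ y y≢v c≢c′))

  -- Otherwise `c` lies between `c′` and `Q`, whence `d P c < d c Q ≤ d c′ Q < d P c′`; but both
  -- pairs of distances sum to `d P Q`.
  before : ∀ {P Q c c′} → Sep c P Q → Sep c′ P Q → d P c < d c Q → d c′ Q < d P c′ → Between P c c′
  before {P} {Q} {c} {c′} sep sep′ Pc<cQ c′Q<Pc′ with sep-split c′ sep
  ... | inj₁ s = sep⇒between (sep-sym s)
  ... | inj₂ s = contradiction (trans (sep⇒between sep) (sym (sep⇒between sep′))) (<⇒≢ (begin-strict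
        d P c + d c Q   <⟨ +-mono-<-≤ (<-trans (<-≤-trans Pc<cQ cQ≤c′Q) c′Q<Pc′) cQ≤c′Q ⟩
        d P c′ + d c′ Q ∎))
    where
    open ≤-Reasoning
    cQ≤c′Q : d c Q ≤ d c′ Q
    cQ≤c′Q = ≤-trans (m≤n+m (d c Q) (d c′ c)) (≤-reflexive (sep⇒between s))

  -- The route `P`, `c`, `y`, `c′`, `Q` is a geodesic, so `y` is `d c y` farther from `P` than `c`.
  no-earlier : ∀ {P Q c c′ y} → Between P c c′ → Between P c′ Q → Between c y c′ → Between P y Q →
               d P y ≤ d P c → c ≡ y
  no-earlier {P} {Q} {c} {c′} {y} Pcc′ Pc′Q cyc′ PyQ Py≤Pc =
    d≡0⇒≡ (m+n≤n⇒m≡0 (d c y) (d P c + (d y c′ + d c′ Q)) (begin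
      d c y + (d P c + (d y c′ + d c′ Q)) ≡⟨ exchange (d c y) (d P c) (d y c′) (d c′ Q) ⟩
      (d P c + (d c y + d y c′)) + d c′ Q ≡⟨ cong (λ k → (d P c + k) + d c′ Q) cyc′ ⟩
      (d P c + d c c′) + d c′ Q           ≡⟨ cong (_+ d c′ Q) Pcc′ ⟩
      d P c′ + d c′ Q                     ≡⟨ Pc′Q ⟩
      d P Q                               ≡⟨ PyQ ⟨
      d P y + d y Q                       ≤⟨ +-mono-≤ Py≤Pc (d-triangle y c′ Q) ⟩
      d P c + (d y c′ + d c′ Q)           ∎))
    where
    open ≤-Reasoning
    exchange : ∀ p q r s → p + (q + (r + s)) ≡ (q + (p + r)) + s
    exchange = solve-∀

  endpoint-sep : ∀ {a b} → Sep a a b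
  endpoint-sep j = joined-≢ˡ j refl

  -- c and c′ are the separators of P and Q closest to the middle of a P-Q geodesic, from the side
  -- of P and from the side of Q respectively.
  centre : ∀ P Q →
    (∃[ c ] (Sep c P Q × d P c ≡ d c Q)) ⊎
    (∃[ c ] ∃[ c′ ] (Gap P Q c c′ × d P c < d c Q × d c′ Q < d P c′))
  centre P Q
    with maximal (λ y → ¬? (joined? y P Q) ×-dec (d P y ≤? d y Q)) (d P)
           -- An endpoint separates trivially, so each half has a candidate.
           (P , endpoint-sep , ≤-trans (≤-reflexive (d-refl P)) z≤n)
       | maximal (λ y → ¬? (joined? y P Q) ×-dec (d y Q ≤? d P y)) (λ y → d y Q)
           (Q , sep-sym endpoint-sep , ≤-trans (≤-reflexive (d-refl Q)) z≤n)
  ... | c , (sep , Pc≤cQ) , best | c′ , (sep′ , c′Q≤Pc′) , best′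
    with d P c ℕ.≟ d c Q | d c′ Q ℕ.≟ d P c′
  ... | yes eq | _ = inj₁ (c , sep , eq)
  ... | no _ | yes eq = inj₁ (c′ , sep′ , sym eq)
  ... | no neq | no neq′ = inj₂ (c , c′ , gap , Pc<cQ , c′Q<Pc′)
    where
    Pc<cQ : d P c < d c Q
    Pc<cQ = ≤∧≢⇒< Pc≤cQ neq
    c′Q<Pc′ : d c′ Q < d P c′
    c′Q<Pc′ = ≤∧≢⇒< c′Q≤Pc′ neq′
    order : Between P c c′
    order = before sep sep′ Pc<cQ c′Q<Pc′
    order′ : Between c c′ Q
    order′ = between-sym (before (sep-sym sep′) (sep-sym sep)
      (subst₂ _<_ (d-sym c′ Q) (d-sym P c′) c′Q<Pc′) (subst₂ _<_ (d-sym P c) (d-sym c Q) Pc<cQ))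
    together : c ≈ c′
    together y y≢c y≢c′ = decidable-stable (joined? y c c′) λ sepcc′ →
      let cyc′ = sep⇒between sepcc′
          sepPQ : Sep y P Q
          sepPQ jPQ =
            -- If `y` did not separate `P` from `Q`, both `c` and `c′` would reach `P` avoiding `y`.
            let toP : ∀ {x} → Joined y x P ⊎ Joined y x Q → Joined y x P
                toP = [ (λ j → j) , (λ j → joined-trans j (joined-sym jPQ)) ]′
            in sepcc′ (joined-trans (toP (between⇒joined (sep⇒between sep) y≢c))
                 (joined-sym (toP (between⇒joined (sep⇒between sep′) y≢c′))))
          PyQ = sep⇒between sepPQ
      -- Now `y` competes with `c` or `c′`, according to its half, and extremality makes them equal.
      in case ≤-total (d P y) (d y Q) of λ where
           (inj₁ Py≤yQ) → y≢c (sym (no-earlier order (sep⇒between sep′) cyc′ PyQ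
             (best y (sepPQ , Py≤yQ))))
           (inj₂ yQ≤Py) → y≢c′ (sym (no-earlier (between-sym order′) (between-sym (sep⇒between sep))
             (between-sym cyc′) (between-sym PyQ)
             (subst₂ _≤_ (d-sym y Q) (d-sym c′ Q) (best′ y (sepPQ , yQ≤Py)))))
    gap : Gap P Q c c′
    gap = record
      { sep = sep ; sep′ = sep′ ; order = order ; order′ = order′ ; together = together
      ; c≢c′ = λ { refl → <-irrefl refl (<-trans Pc<cQ c′Q<Pc′) } }

  -- If c were P, then d P Q ≤ 2 + 1 because c and c′ share a block.
  gap-start≢ : ∀ {P Q c c′} → (∀ {a b} → a ≈ b → d a b ≤ 2) → Gap P Q c c′ → d c′ Q < d P c′ →
               4 ≤ d P Q → P ≢ c
  gap-start≢ {P} {Q} {c} {c′} d≤2 gap c′Q<Pc′ 4≤PQ refl = <⇒≱ (begin-strict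
      d P Q           ≡⟨ Gap.order′ gap ⟨
      d P c′ + d c′ Q <⟨ +-monoʳ-< (d P c′) c′Q<Pc′ ⟩
      d P c′ + d P c′ ≤⟨ +-mono-≤ (d≤2 (Gap.together gap)) (d≤2 (Gap.together gap)) ⟩
      4               ∎) 4≤PQ
    where open ≤-Reasoning

  gap-end≢ : ∀ {P Q c} → d P c < d c Q → Q ≢ c
  gap-end≢ {P} {Q} lt refl = <⇒≱ lt (≤-trans (≤-reflexive (d-refl Q)) z≤n)

  half≤end : ∀ {P Q} u → 4 ≤ d P Q → 2 ≤ d u P ⊎ 2 ≤ d u Q
  half≤end {P} {Q} u 4≤PQ with 2 ≤? d u P | 2 ≤? d u Q
  ... | yes le | _      = inj₁ le
  ... | no _   | yes le = inj₂ le
  ... | no nle | no nle′ = contradiction (begin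
        4             ≤⟨ 4≤PQ ⟩
        d P Q         ≤⟨ d-triangle P u Q ⟩
        d P u + d u Q ≡⟨ cong (_+ d u Q) (d-sym P u) ⟩
        d u P + d u Q ≤⟨ +-mono-≤ (≤-pred (≰⇒> nle)) (≤-pred (≰⇒> nle′)) ⟩
        2             ∎) λ { (s≤s (s≤s ())) }
    where open ≤-Reasoning

  -- Farthest vertices in the class

  module ClassB (inB : InClassB G) where

    twoCuts : ∀ a b c → a ≈ b → b ≈ c → a ≈ c →
      IsCutVertex G a → IsCutVertex G b → IsCutVertex G c → a ≡ b ⊎ a ≡ c ⊎ b ≡ c
    twoCuts a b c a≈b b≈c a≈c =
      let S , block , a∈ , b∈ , c∈ = block-containing a≈b b≈c a≈c
      in proj₂ (proj₂ inB) S block a b c a∈ b∈ c∈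

    ≈⇒d≤2 : ∀ {a b} → a ≈ b → d a b ≤ 2
    ≈⇒d≤2 a≈b =
      let S , block , a∈ , b∈ , _ = block-containing a≈b ≈-refl a≈b
      in completeBipartite⇒d≤2 (proj₂ (proj₁ inB) S block) a∈ b∈

    farthest-is-end : ∀ {P Q} → Diametral P Q → 4 ≤ d P Q → ∀ u v → d u v ≤ d u P ⊎ d u v ≤ d u Q
    farthest-is-end {P} {Q} diam 4≤PQ u v with centre P Q
    ... | inj₁ (c , sep , eq) with sep-split u sep
    ...   | inj₁ s = inj₁ (farther-end v (diametral-sym diam) (sep-sym sep)
                       (≤-reflexive (trans (d-sym Q c) (trans (sym eq) (d-sym P c)))) s)
    ...   | inj₂ s = inj₂ (farther-end v diam sep (≤-reflexive eq) s)
    farthest-is-end {P} {Q} diam 4≤PQ u v | inj₂ (c , c′ , gap , Pc<cQ , c′Q<Pc′)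
      with joined? c u Q | joined? c′ u P | joined? c v Q | joined? c′ v P
    ... | no s | _ | _ | _ = inj₂ (farther-end v diam (Gap.sep gap) (<⇒≤ Pc<cQ) s)
    ... | yes _ | no s | _ | _ =
          inj₁ (farther-end v (diametral-sym diam) (sep-sym (Gap.sep′ gap))
            (subst₂ _≤_ (d-sym c′ Q) (d-sym P c′) (<⇒≤ c′Q<Pc′)) s)
    ... | yes j | yes _ | no s | _ = inj₁ (opposite-end diam (Gap.sep gap) j s)
    ... | yes _ | yes j | yes _ | no s =
          inj₂ (opposite-end (diametral-sym diam) (sep-sym (Gap.sep′ gap)) j s)
    ... | yes juQ | yes juP | yes jvQ | yes jvP =
          [ inj₁ ∘ ≤-trans duv≤2 , inj₂ ∘ ≤-trans duv≤2 ]′ (half≤end u 4≤PQ)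
      where
      P≢c : P ≢ c
      P≢c = gap-start≢ ≈⇒d≤2 gap c′Q<Pc′ 4≤PQ
      Q≢c′ : Q ≢ c′
      Q≢c′ = gap-start≢ ≈⇒d≤2 (gap-sym gap) (subst₂ _<_ (d-sym P c) (d-sym c Q) Pc<cQ)
               (≤-trans 4≤PQ (≤-reflexive (d-sym P Q)))
      cut : IsCutVertex G c
      cut = sep⇒cut (Gap.sep gap) P≢c (gap-end≢ Pc<cQ)
      cut′ : IsCutVertex G c′
      cut′ = sep⇒cut (Gap.sep′ gap) (gap-end≢ (subst₂ _<_ (d-sym c′ Q) (d-sym P c′) c′Q<Pc′)) Q≢c′
      duv≤2 : d u v ≤ 2
      duv≤2 = ≈⇒d≤2 (≈-both⇒≈ (Gap.c≢c′ gap)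
        (inside-gap twoCuts gap cut cut′ juQ juP)
        (inside-gap twoCuts (gap-sym gap) cut′ cut juP juQ)
        (inside-gap twoCuts gap cut cut′ jvQ jvP)
        (inside-gap twoCuts (gap-sym gap) cut′ cut jvP jvQ))

  -- Eccentricities, matrix entries and irreducibility

  dist-unique : ∀ {u v k} → Dist G u v k → k ≡ d u v
  dist-unique (w , least) = ≤-antisym (least _ (walk _ _)) (d-least w)

  eccentric : ∀ u → ∃[ v ] Ecc G u (d u v)
  eccentric u with maximal {P = λ x → x ≡ x} (λ _ → yes refl) (d u) (u , refl)
  ... | v , _ , far = v , (v , isDist u v) ,
        λ x k dist → ≤-trans (≤-reflexive (dist-unique dist)) (far x refl)

  diametral-pair : ∀ {D} → Diam G D → ∃[ P ] ∃[ Q ] (d P Q ≡ D × Diametral P Q)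
  diametral-pair ((P , (Q , dist) , _) , ecc≤D) = P , Q , sym D≡ , λ x y →
    let v , e = eccentric x
    in ≤-trans (proj₂ e y _ (isDist x y)) (≤-trans (ecc≤D x _ e) (≤-reflexive D≡))
    where D≡ = dist-unique dist

  -- `d u v` is the eccentricity of `u` and at most that of `v`, so it equals the minimum of the
  -- two.
  ecc-entry≢0 : ∀ {M u v} → IsEccMatrix G M → (∀ x → d u x ≤ d u v) → 0 < d u v →
                M u v ≢ 0 × M v u ≢ 0
  ecc-entry≢0 {M} {u} {v} isEcc far pos =
    (λ z → entry≢0 (trans (sym z) (isEcc u v _ _ _ (isDist u v) eccᵤ eccᵥ))
       (sym (m≤n⇒m⊓n≡m (proj₂ eccᵥ u _ dist-vu)))) ,
    (λ z → entry≢0 (trans (sym z) (isEcc v u _ _ _ dist-vu eccᵥ eccᵤ))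
       (sym (m≥n⇒m⊓n≡n (proj₂ eccᵥ u _ dist-vu))))
    where
    v′ = proj₁ (eccentric v)
    eccᵥ : Ecc G v (d v v′)
    eccᵥ = proj₂ (eccentric v)
    dist-vu : Dist G v u (d u v)
    dist-vu = subst (Dist G v u) (d-sym v u) (isDist v u)
    eccᵤ : Ecc G u (d u v)
    eccᵤ = (v , isDist u v) , λ x k dist → ≤-trans (≤-reflexive (dist-unique dist)) (far x)
    entry≢0 : ∀ {m} → 0 ≡ (if d u v ≡ᵇ m then d u v else 0) → d u v ≡ m → ⊥
    entry≢0 {m} eq d≡m with d u v ≡ᵇ m | Equivalence.to T-≡ (≡⇒≡ᵇ (d u v) m d≡m)
    ... | true | refl = <-irrefl eq pos

-- The indices placed in the first diagonal block are closed under passing from v to any u with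
-- M u v ≢ 0, so the hubs P and Q force this block to be everything.
all-near-hub⇒irreducible : ∀ {n} {M : Fin n → Fin n → ℕ} {P Q : Fin n} →
  (∀ u → (M u P ≢ 0 × M P u ≢ 0) ⊎ (M u Q ≢ 0 × M Q u ≢ 0)) → M P Q ≢ 0 × M Q P ≢ 0 →
  Irreducible M
all-near-hub⇒irreducible {n} {M} {P} {Q} near (PQ , QP) (σ , k , 0<k , k<n , zero-block) =
  -- Position `0` is low, hence `P` is, hence the index at position `k` is, giving `k < k`.
  <-irrefl (trans (cong toℕ (inverseˡ σ)) (toℕ-fromℕ< k<n))
    (from-P _ (to-P _ (subst (_< k) (sym first≡0) 0<k)))
  where
  Low : Fin n → Set
  Low x = toℕ (σ ⟨$⟩ˡ x) < k
  transfer : ∀ {x y} → M x y ≢ 0 → Low y → Low x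
  transfer {x} {y} Mxy≢0 low = ≰⇒> λ k≤x → Mxy≢0
    (trans (sym (cong₂ M (inverseʳ σ) (inverseʳ σ))) (zero-block _ _ k≤x low))
  to-P : ∀ u → Low u → Low P
  to-P u low with near u
  ... | inj₁ (_ , Pu) = transfer Pu low
  ... | inj₂ (_ , Qu) = transfer PQ (transfer Qu low)
  from-P : ∀ u → Low P → Low u
  from-P u low with near u
  ... | inj₁ (uP , _) = transfer uP low
  ... | inj₂ (uQ , _) = transfer uQ (transfer QP low)
  0<n : 0 < n
  0<n = <-trans 0<k k<n
  first≡0 : toℕ (σ ⟨$⟩ˡ (σ ⟨$⟩ʳ fromℕ< 0<n)) ≡ 0
  first≡0 = trans (cong toℕ (inverseˡ σ)) (toℕ-fromℕ< 0<n)

theorem4p10 : ∀ {n} (G : Graph n) → InClassB G → (∃[ D ] (Diam G D × 4 ≤ D)) →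
    (M : Fin n → Fin n → ℕ) → IsEccMatrix G M → Irreducible M
theorem4p10 {n} G inB (D , diam , 4≤D) M isEcc reducible =
  -- Irreducibility is a negation, so the distances and the decisions on `Joined` may be assumed.
  ¬¬-∀ (λ u → ¬¬-∀ λ v → ¬¬-least (proj₁ (proj₁ inB) u v ∈⊤ ∈⊤)) λ dist →
  ¬¬-∀ (λ z → ¬¬-∀ λ a → ¬¬-∀ λ b → ¬¬-excluded-middle) λ joined? →
  conclude (λ u v → proj₁ (dist u v)) (λ u v → proj₂ (dist u v)) joined?
  where
  conclude : (d : Fin n → Fin n → ℕ) → (∀ u v → Dist G u v (d u v)) →
             (∀ z a b → Dec (Walks.Joined G z a b)) → ⊥
  conclude d isDist joined? with Geometry.diametral-pair G d isDist joined? diam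
  ... | P , Q , refl , diametral =
        all-near-hub⇒irreducible {M = M} near
          (ecc-entry≢0 isEcc (diametral P) (≤-trans (s≤s z≤n) 4≤D)) reducible
    where
    open Geometry G d isDist joined?
    open ClassB inB
    near : ∀ u → (M u P ≢ 0 × M P u ≢ 0) ⊎ (M u Q ≢ 0 × M Q u ≢ 0)
    near u with eccentric u
    ... | v , (_ , far) = [ inj₁ ∘ entry , inj₂ ∘ entry ]′ (farthest-is-end diametral 4≤D u v)
      where
      uv≥ : ∀ x → d u x ≤ d u v
      uv≥ x = far x _ (isDist u x)
      0<uv : 0 < d u v
      0<uv = ≤-trans (s≤s z≤n) ([ (λ le → ≤-trans le (uv≥ P)) , (λ le → ≤-trans le (uv≥ Q)) ]′
                                 (half≤end u 4≤D))
      entry : ∀ {R} → d u v ≤ d u R → M u R ≢ 0 × M R u ≢ 0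
      entry uv≤uR = ecc-entry≢0 isEcc (λ x → ≤-trans (uv≥ x) uv≤uR) (≤-trans 0<uv uv≤uR)
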